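{- Let $\mathrm{M}$ be the rank $9$ binary matroid on the ground set $\{1,\dots,18\}$ represented over $\mathbb{F}_2$ by the following $9\times 18$ matrix, with column $j$ corresponding to the element $j$: $$\left(\begin{array}{cccccccccccccccccc} 0 & 0 & 1 & 1 & 0 & 0 & 0 & 1 & 0 & 1 & 0 & 1 & 0 & 0 & 0 & 0 & 0 & 0 \\ 0 & 1 & 0 & 1 & 0 & 1 & 0 & 0 & 0 & 0 & 0 & 0 & 1 & 1 & 0 & 0 & 0 & 0 \\ 0 & 0 & 0 & 0 & 0 & 0 & 1 & 1 & 0 & 0 & 0 & 0 & 0 & 1 & 0 & 1 & 0 & 1 \\ 1 & 1 & 1 & 1 & 0 & 0 & 0 & 0 & 0 & 0 & 0 & 0 & 0 & 0 & 0 & 0 & 0 & 0 \\ 0 & 0 & 1 & 1 & 1 & 1 & 0 & 0 & 0 & 0 & 0 & 0 & 0 & 0 & 0 & 0 & 0 & 0 \\ 0 & 0 & 0 & 0 & 0 & 0 & 1 & 1 & 1 & 1 & 0 & 0 & 0 & 0 & 0 & 0 & 0 & 0 \\ 0 & 0 & 0 & 0 & 0 & 0 & 1 & 1 & 0 & 0 & 1 & 1 & 0 & 0 & 0 & 0 & 0 & 0 \\ 0 & 0 & 0 & 0 & 0 & 0 & 0 & 0 & 0 & 0 & 0 & 0 & 1 & 1 & 1 & 1 & 0 & 0 \\ 0 & 0 & 0 & 0 & 0 & 0 & 0 & 0 & 0 & 0 & 0 & 0 & 1 & 1 & 0 & 0 & 1 & 1 \end{array}\right).$$ Then both of the following hold.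 (a) There exist unordered pairs of bases $\{B_1,B_2\}$ and $\{B_1',B_2'\}$ of $\mathrm{M}$ such that the multiset union of $B_1$ and $B_2$ equals the multiset union of $B_1'$ and $B_2'$, but $\{B_1',B_2'\}$ cannot be obtained from $\{B_1,B_2\}$ by any finite sequence of steps, each of which replaces the current unordered pair of bases by a symmetric exchange of it. (b) There exist an integer $s\ge 1$ and sequences of bases $(B_1,\dots,B_s)$ and $(B_1',\dots,B_s')$ of $\mathrm{M}$ such that the multiset union of $B_1,\dots,B_s$ equals the multiset union of $B_1',\dots,B_s'$, but the multiset $\{B_1',\dots,B_s'\}$ cannot be obtained from the multiset $\{B_1,\dots,B_s\}$ by any finite sequence of steps, each of which chooses two members $B_i,B_j$ ($i\neq j$) of the current multiset and a symmetric exchange $(\tilde B_i,\tilde B_j)$ of $(B_i,B_j)$, and replaces $B_i,B_j$ by $\tilde B_i,\tilde B_j$.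
   Context: The matroid represented by a matrix over a field is the matroid on the index set of its columns in which a set of indices is independent if and only if the corresponding columns (as an indexed family) are linearly independent over that field. Given bases $B_1$ and $B_2$ of a matroid, a symmetric exchange of the ordered pair $(B_1,B_2)$ is an ordered pair of bases $(\tilde B_1,\tilde B_2)$ for which there are $x\in B_1$ and $y\in B_2$ such that $\tilde B_1=(B_1\setminus x)\cup y$ and $\tilde B_2=(B_2\setminus y)\cup x$. A symmetric exchange of an unordered pair $\{B_1,B_2\}$ is the unordered pair $\{\tilde B_1,\tilde B_2\}$ underlying a symmetric exchange of $(B_1,B_2)$. Multiset unions count elements with multiplicity. -}

module Defs where

open import Data.Bool.Base using (if_then_else_)
open import Data.Fin.Base using (Fin; zero; suc)
open import Data.Fin.Properties using (any?; all?) renaming (_≟_ to _≟ᶠ_)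
open import Data.Fin.Subset
  using (Subset; inside; outside; ⊥; ⁅_⁆; _∈_; _∉_; _⊆_; _∪_; _-_; ∣_∣)
open import Data.Fin.Subset.Properties
  using ( _∈?_; _⊆?_; anySubset?; ∉⊥; x∈⁅x⁆; x∈⁅y⁆⇒x≡y; x∈p∪q⁻
        ; ∣⊥∣≡0; nonempty?; Empty-unique )
open import Data.Nat.Base as ℕ using (ℕ; _≤_; _<_; s≤s; s≤s⁻¹)
import Data.Nat.Properties as ℕ
-- The library gives _+_ and _*_ on Parity the same precedence.
open import Data.Parity.Base using (Parity; 0ℙ; 1ℙ; _*_) renaming (_+_ to infixl 6 _+_)
open import Data.Parity.Properties
  using ( _≟_; +-*-semiring; *-zeroʳ; *-identityˡ; *-assoc; *-comm; *-distribʳ-+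
        ; *-distribˡ-+; +-identityʳ; p+p≡0ℙ )
open import Data.Product.Base using (_×_; _,_; ∃; ∃₂; proj₁; proj₂; swap)
open import Data.Sum.Base using (_⊎_; inj₁; inj₂; [_,_]′)
open import Data.Vec.Base as Vec using (Vec; []; _∷_; lookup; count; _[_]≔_; here; there)
open import Data.Vec.Functional using (Vector)
open import Data.Vec.Functional.Relation.Binary.Permutation using (_↭_)
open import Data.Vec.Properties
  using ([]=⇒lookup; lookup⇒[]=; lookup∘tabulate)
open import Function.Base using (_∘_; case_of_)
open import Level using (0ℓ)
open import Relation.Binary.Construct.Closure.ReflexiveTransitive using (Star)
open import Relation.Binary.Core using (Rel)
open import Relation.Binary.PropositionalEquality
  using (_≡_; _≢_; refl; sym; trans; cong; cong₂; subst; module ≡-Reasoning)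
open import Relation.Nullary using (¬_; Dec; yes; no; does; contradiction)
open import Relation.Nullary.Decidable using (_×-dec_; ¬?; decidable-stable)
open import Relation.Unary using (Pred)

open import Algebra.Properties.Semiring.Sum +-*-semiring
  using (sum; ∑-distrib-+; ∑-comm; *-distribˡ-sum; *-distribʳ-sum; sum-cong-≗; sum-replicate-zero)

private variable
  k m n s : ℕ

record Matroid (n : ℕ) : Set₁ where
  field
    Independent   : Pred (Subset n) 0ℓ
    independent-⊥ : Independent ⊥
    independent-⊆ : ∀ {I J} → I ⊆ J → Independent J → Independent I
    augmentation  : ∀ {I J} → Independent I → Independent J → ∣ I ∣ < ∣ J ∣ →
                    ∃ λ j → j ∈ J × j ∉ I × Independent (I ∪ ⁅ j ⁆)

  IsBasis : Pred (Subset n) 0ℓ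
  IsBasis B = Independent B × (∀ I → Independent I → B ⊆ I → I ≡ B)

module _ (M : Matroid n) where
  open Matroid M

  SymmetricExchange : Rel (Subset n × Subset n) 0ℓ
  SymmetricExchange (B₁ , B₂) (B̃₁ , B̃₂) =
    (IsBasis B₁ × IsBasis B₂) × (IsBasis B̃₁ × IsBasis B̃₂) ×
    ∃₂ λ x y → x ∈ B₁ × y ∈ B₂ × B̃₁ ≡ (B₁ - x) ∪ ⁅ y ⁆ × B̃₂ ≡ (B₂ - y) ∪ ⁅ x ⁆

  -- An unordered pair is represented by either of its orderings, so the
  -- closure may also swap the two components at any point.
  PairReachable : Rel (Subset n × Subset n) 0ℓ
  PairReachable = Star λ P Q → SymmetricExchange P Q ⊎ Q ≡ swap P

  ExchangeStep : Rel (Vector (Subset n) s) 0ℓ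
  ExchangeStep B B̃ = ∃₂ λ i j → i ≢ j
    × SymmetricExchange (B i , B j) (B̃ i , B̃ j)
    × (∀ k → k ≢ i → k ≢ j → B̃ k ≡ B k)

  -- A multiset of size s is represented by any of its enumerations, so the
  -- closure may also permute the entries at any point.
  MultisetReachable : Rel (Vector (Subset n) s) 0ℓ
  MultisetReachable = Star λ B C → ExchangeStep B C ⊎ B ↭ C

multiplicity : Vector (Subset n) s → Fin n → ℕ
multiplicity B e = count (e ∈?_) (Vec.tabulate B)

SameMultisetUnion : Rel (Vector (Subset n) s) 0ℓ
SameMultisetUnion B C = ∀ e → multiplicity B e ≡ multiplicity C e

-- Parity serves as 𝔽₂: 0ℙ and 1ℙ are its two elements.
Matrix : ℕ → ℕ → Set
Matrix m n = Vec (Vec Parity n) m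

entry : Matrix m n → Fin m → Fin n → Parity
entry A i j = lookup (lookup A i) j

SupportedOn : Subset n → Pred (Vector Parity n) 0ℓ
SupportedOn S c = ∀ j → j ∉ S → c j ≡ 0ℙ

-- A coefficient family indexed by S is represented by its extension by zero.
LinearlyIndependent : Matrix m n → Pred (Subset n) 0ℓ
LinearlyIndependent A S = ∀ c → SupportedOn S c →
  (∀ i → sum (λ j → c j * entry A i j) ≡ 0ℙ) → ∀ j → c j ≡ 0ℙ

module BinaryLinearAlgebra where

  open ≡-Reasoning

  χ : Subset n → Vector Parity n
  χ S j = if lookup S j then 1ℙ else 0ℙ

  χ-∈ : ∀ {S : Subset n} {j} → j ∈ S → χ S j ≡ 1ℙ
  χ-∈ j∈S rewrite []=⇒lookup j∈S = refl

  χ-supported : (S : Subset n) → SupportedOn S (χ S)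
  χ-supported S j j∉S with lookup S j in eq
  ... | inside  = contradiction (lookup⇒[]= j S eq) j∉S
  ... | outside = refl

  support : Vector Parity n → Subset n
  support c = Vec.tabulate λ j → does (c j ≟ 1ℙ)

  χ-support : (c : Vector Parity n) → ∀ j → χ (support c) j ≡ c j
  χ-support c j rewrite lookup∘tabulate (λ j → does (c j ≟ 1ℙ)) j with c j
  ... | 0ℙ = refl
  ... | 1ℙ = refl

  support-⊆ : ∀ {c : Vector Parity n} {S} → SupportedOn S c → support c ⊆ S
  support-⊆ {c = c} {S} c⊆S {j} j∈ = decidable-stable (j ∈? S) λ j∉S →
    case trans (sym (χ-∈ j∈)) (trans (χ-support c j) (c⊆S j j∉S)) of λ ()

  sum-zero : (f : Vector Parity n) → (∀ j → f j ≡ 0ℙ) → sum f ≡ 0ℙ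
  sum-zero {n} f f≡0 = trans (sum-cong-≗ f≡0) (sum-replicate-zero n)

  sum-χ⁅⁆ : (p : Fin n) (f : Vector Parity n) → sum (λ j → χ ⁅ p ⁆ j * f j) ≡ f p
  sum-χ⁅⁆ zero f = trans
    (cong (f zero +_) (sum-zero (λ j → χ ⊥ j * f (suc j)) λ j →
      cong (_* f (suc j)) (χ-supported ⊥ j ∉⊥)))
    (+-identityʳ (f zero))
  sum-χ⁅⁆ (suc p) f = sum-χ⁅⁆ p (f ∘ suc)

  sum-+* : (c d f : Vector Parity n) →
    sum (λ j → (c j + d j) * f j) ≡ sum (λ j → c j * f j) + sum (λ j → d j * f j)
  sum-+* c d f = trans (sum-cong-≗ λ j → *-distribʳ-+ (f j) (c j) (d j))
    (∑-distrib-+ (λ j → c j * f j) (λ j → d j * f j))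

  sum-** : ∀ a (c f : Vector Parity n) →
    sum (λ j → (a * c j) * f j) ≡ a * sum (λ j → c j * f j)
  sum-** a c f = trans (sum-cong-≗ λ j → *-assoc a (c j) (f j))
    (sym (*-distribˡ-sum a (λ j → c j * f j)))

  remove : Subset n → Fin n → Subset n
  remove S p = S [ p ]≔ outside

  ∣S∣≤1+∣remove∣ : (S : Subset n) (p : Fin n) → ∣ S ∣ ≤ ℕ.suc ∣ remove S p ∣
  ∣S∣≤1+∣remove∣ (outside ∷ S) zero    = ℕ.n≤1+n ∣ S ∣
  ∣S∣≤1+∣remove∣ (inside  ∷ S) zero    = ℕ.≤-refl
  ∣S∣≤1+∣remove∣ (outside ∷ S) (suc p) = ∣S∣≤1+∣remove∣ S p
  ∣S∣≤1+∣remove∣ (inside  ∷ S) (suc p) = s≤s (∣S∣≤1+∣remove∣ S p)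

  ∈-remove⁻ : (S : Subset n) (p : Fin n) {j : Fin n} → j ∈ remove S p → j ∈ S × j ≢ p
  ∈-remove⁻ (_ ∷ S) zero    (there j∈) = there j∈ , λ ()
  ∈-remove⁻ (_ ∷ S) (suc p) here       = here , λ ()
  ∈-remove⁻ (_ ∷ S) (suc p) (there j∈) with ∈-remove⁻ S p j∈
  ... | j∈S , j≢p = there j∈S , λ { refl → j≢p refl }

  positive⇒∈ : {S : Subset n} → 0 < ∣ S ∣ → ∃ (_∈ S)
  positive⇒∈ {n} {S} 0<∣S∣ = decidable-stable (nonempty? S) λ empty →
    ℕ.<-irrefl (sym (trans (cong ∣_∣ (Empty-unique empty)) (∣⊥∣≡0 n))) 0<∣S∣

  -- A homogeneous system with more unknowns (J) than equations (I) has a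
  -- nonzero solution; by elimination of one unknown per equation.
  nonzeroSolution : (E : Fin k → Vector Parity n) (I : Subset k) (J : Subset n) →
    ∣ I ∣ < ∣ J ∣ →
    ∃ λ c → SupportedOn J c × (∃ λ j → c j ≡ 1ℙ) ×
            (∀ i → i ∈ I → sum (λ j → c j * E i j) ≡ 0ℙ)
  nonzeroSolution E [] J 0<∣J∣ with positive⇒∈ 0<∣J∣
  ... | p , p∈J = χ ⁅ p ⁆
    , (λ j j∉J → χ-supported ⁅ p ⁆ j λ j∈ → j∉J (subst (_∈ J) (sym (x∈⁅y⁆⇒x≡y p j∈)) p∈J))
    , (p , χ-∈ (x∈⁅x⁆ p)) , λ ()
  nonzeroSolution E (outside ∷ I) J lt with nonzeroSolution (E ∘ suc) I J lt
  ... | c , c⊆J , c≢0 , sol = c , c⊆J , c≢0 , λ { (suc i) (there i∈I) → sol i i∈I }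
  nonzeroSolution {n = n} E (inside ∷ I) J lt
    with any? (λ j → (j ∈? J) ×-dec (E zero j ≟ 1ℙ))
  ... | no noPivot with nonzeroSolution (E ∘ suc) I J (ℕ.<-trans (ℕ.n<1+n _) lt)
  ...   | c , c⊆J , c≢0 , sol = c , c⊆J , c≢0 , λ where
            zero    here        → sum-zero (λ j → c j * E zero j) vanish
            (suc i) (there i∈I) → sol i i∈I
    where
    vanish : ∀ j → c j * E zero j ≡ 0ℙ
    vanish j with j ∈? J | E zero j in eq
    ... | no j∉J  | e  = cong (_* e) (c⊆J j j∉J)
    ... | yes j∈J | 0ℙ = *-zeroʳ (c j)
    ... | yes j∈J | 1ℙ = contradiction (j , j∈J , eq) noPivot
  nonzeroSolution {n = n} E (inside ∷ I) J lt
      | yes (p , p∈J , Ep≡1)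
    with nonzeroSolution (λ i j → E (suc i) j + E (suc i) p * E zero j) I (remove J p)
                 (s≤s⁻¹ (ℕ.<-≤-trans lt (∣S∣≤1+∣remove∣ J p)))
  ... | c , c⊆J∖p , (q , cq≡1) , sol =
    c′ , c′⊆J , (q , c′q≡1) , λ where
      zero    here        → begin
        sum (λ j → c′ j * E zero j)  ≡⟨ expand (E zero) ⟩
        t + t * E zero p             ≡⟨ cong (λ e → t + t * e) Ep≡1 ⟩
        t + t * 1ℙ                   ≡⟨ cong (t +_) (trans (*-comm t 1ℙ) (*-identityˡ t)) ⟩
        t + t                        ≡⟨ p+p≡0ℙ t ⟩
        0ℙ                           ∎
      (suc i) (there i∈I) → let e = E (suc i) in begin
        sum (λ j → c′ j * e j)                                ≡⟨ expand e ⟩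
        sum (λ j → c j * e j) + t * e p                       ≡⟨ cong (sum (λ j → c j * e j) +_) (trans (*-comm t (e p)) (pull e)) ⟩
        sum (λ j → c j * e j) + sum (λ j → c j * (e p * E zero j))
          ≡⟨ sym (∑-distrib-+ (λ j → c j * e j) (λ j → c j * (e p * E zero j))) ⟩
        sum (λ j → c j * e j + c j * (e p * E zero j))
          ≡⟨ sum-cong-≗ (λ j → sym (*-distribˡ-+ (c j) (e j) (e p * E zero j))) ⟩
        sum (λ j → c j * (e j + e p * E zero j))              ≡⟨ sol i i∈I ⟩
        0ℙ                                                    ∎
    where
    t : Parity
    t = sum (λ j → c j * E zero j)

    c′ : Vector Parity n
    c′ j = c j + t * χ ⁅ p ⁆ j

    expand : ∀ f → sum (λ j → c′ j * f j) ≡ sum (λ j → c j * f j) + t * f p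
    expand f = trans (sum-+* c (λ j → t * χ ⁅ p ⁆ j) f)
      (cong (sum (λ j → c j * f j) +_)
        (trans (sum-** t (χ ⁅ p ⁆) f) (cong (t *_) (sum-χ⁅⁆ p f))))

    pull : ∀ (e : Vector Parity n) → e p * t ≡ sum (λ j → c j * (e p * E zero j))
    pull e = trans (*-distribˡ-sum (e p) (λ j → c j * E zero j)) (sum-cong-≗ λ j →
      trans (sym (*-assoc (e p) (c j) _))
        (trans (cong (_* E zero j) (*-comm (e p) (c j))) (*-assoc (c j) (e p) _)))

    c′≡c : ∀ j → j ≢ p → c′ j ≡ c j
    c′≡c j j≢p = trans
      (cong (λ d → c j + t * d) (χ-supported ⁅ p ⁆ j (j≢p ∘ x∈⁅y⁆⇒x≡y p)))
      (trans (cong (c j +_) (*-zeroʳ t)) (+-identityʳ (c j)))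

    c′⊆J : SupportedOn J c′
    c′⊆J j j∉J = trans (c′≡c j λ { refl → j∉J p∈J })
      (c⊆J∖p j (j∉J ∘ proj₁ ∘ ∈-remove⁻ J p))

    c′q≡1 : c′ q ≡ 1ℙ
    c′q≡1 = trans (c′≡c q λ { refl →
      case trans (sym cq≡1) (c⊆J∖p p (λ p∈ → proj₂ (∈-remove⁻ J p p∈) refl)) of λ () }) cq≡1

  module _ (A : Matrix m n) where

    Combination : Vector Parity n → Fin n → Set
    Combination c j = ∀ i → sum (λ k → c k * entry A i k) ≡ entry A i j

    Spanned : Subset n → Fin n → Set
    Spanned I j = ∃ λ K → K ⊆ I × Combination (χ K) j

    spanned? : ∀ I j → Dec (Spanned I j)
    spanned? I j = anySubset? λ K → (K ⊆? I) ×-dec all? λ i → _ ≟ _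

    spanned : ∀ {I j} c → SupportedOn I c → Combination c j → Spanned I j
    spanned c c⊆I comb = support c , support-⊆ c⊆I , λ i →
      trans (sum-cong-≗ λ k → cong (_* entry A i k) (χ-support c k)) (comb i)

    linearlyIndependent-∪ : ∀ {I j} → LinearlyIndependent A I → ¬ Spanned I j →
                            LinearlyIndependent A (I ∪ ⁅ j ⁆)
    linearlyIndependent-∪ {I} {j} indep j∉span c c⊆ c≡0 with c j in cj
    ... | 0ℙ = indep c c⊆I c≡0
      where
      c⊆I : SupportedOn I c
      c⊆I k k∉I with k ≟ᶠ j
      ... | yes refl = cj
      ... | no k≢j   = c⊆ k ([ k∉I , k≢j ∘ x∈⁅y⁆⇒x≡y j ]′ ∘ x∈p∪q⁻ I ⁅ j ⁆)
    ... | 1ℙ = contradiction (spanned d d⊆I comb) j∉span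
      where
      d : Vector Parity n
      d k = c k + χ ⁅ j ⁆ k

      d⊆I : SupportedOn I d
      d⊆I k k∉I with k ≟ᶠ j
      ... | yes refl = cong₂ _+_ cj (χ-∈ (x∈⁅x⁆ j))
      ... | no k≢j   = cong₂ _+_
        (c⊆ k ([ k∉I , k≢j ∘ x∈⁅y⁆⇒x≡y j ]′ ∘ x∈p∪q⁻ I ⁅ j ⁆))
        (χ-supported ⁅ j ⁆ k (k≢j ∘ x∈⁅y⁆⇒x≡y j))

      comb : Combination d j
      comb i = trans (sum-+* c (χ ⁅ j ⁆) (entry A i))
        (cong₂ _+_ (c≡0 i) (sum-χ⁅⁆ j (entry A i)))

    ∈⇒spanned : ∀ {I j} → j ∈ I → Spanned I j
    ∈⇒spanned {I} {j} j∈I = ⁅ j ⁆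
      , (λ k∈ → subst (_∈ I) (sym (x∈⁅y⁆⇒x≡y j k∈)) j∈I)
      , λ i → sum-χ⁅⁆ j (entry A i)

    linearlyIndependent-augmentation : ∀ {I J} →
      LinearlyIndependent A I → LinearlyIndependent A J → ∣ I ∣ < ∣ J ∣ →
      ∃ λ j → j ∈ J × j ∉ I × LinearlyIndependent A (I ∪ ⁅ j ⁆)
    linearlyIndependent-augmentation {I} {J} indepI indepJ lt
      with any? (λ j → (j ∈? J) ×-dec ¬? (spanned? I j))
    ... | yes (j , j∈J , j∉span) =
      j , j∈J , j∉span ∘ ∈⇒spanned , linearlyIndependent-∪ indepI j∉span
    ... | no allSpanned = contradiction (trans (sym eq≡1) (indepJ e e⊆J e≡0 q)) λ ()
      where
      coefficients : ∀ j → ∃ λ d → j ∈ J → SupportedOn I d × Combination d j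
      coefficients j with spanned? I j
      ... | yes (K , K⊆I , comb) = χ K , λ _ → (λ k k∉I → χ-supported K k (k∉I ∘ K⊆I)) , comb
      ... | no j∉span = χ ⊥ , λ j∈J → contradiction (j , j∈J , j∉span) allSpanned

      C : Fin n → Vector Parity n
      C j = proj₁ (coefficients j)

      solution = nonzeroSolution (λ k j → C j k) I J lt
      e = proj₁ solution
      e⊆J = proj₁ (proj₂ solution)
      q = proj₁ (proj₁ (proj₂ (proj₂ solution)))
      eq≡1 = proj₂ (proj₁ (proj₂ (proj₂ solution)))

      eC≡0 : ∀ k → sum (λ j → e j * C j k) ≡ 0ℙ
      eC≡0 k with k ∈? I
      ... | yes k∈I = proj₂ (proj₂ (proj₂ solution)) k k∈I
      ... | no k∉I  = sum-zero (λ j → e j * C j k) vanish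
        where
        vanish : ∀ j → e j * C j k ≡ 0ℙ
        vanish j with j ∈? J
        ... | yes j∈J = trans (cong (e j *_) (proj₁ (proj₂ (coefficients j) j∈J) k k∉I)) (*-zeroʳ (e j))
        ... | no j∉J  = cong (_* C j k) (e⊆J j j∉J)

      e≡0 : ∀ i → sum (λ j → e j * entry A i j) ≡ 0ℙ
      e≡0 i = begin
        sum (λ j → e j * a j)                          ≡⟨ sum-cong-≗ step ⟩
        sum (λ j → sum (λ k → e j * C j k * a k))      ≡⟨ ∑-comm (λ j k → e j * C j k * a k) ⟩
        sum (λ k → sum (λ j → e j * C j k * a k))      ≡⟨ sum-zero (λ k → sum (λ j → e j * C j k * a k)) column ⟩
        0ℙ                                             ∎
        where
        a : Vector Parity n
        a = entry A i

        step : ∀ j → e j * a j ≡ sum (λ k → e j * C j k * a k)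
        step j with j ∈? J
        ... | yes j∈J = trans (cong (e j *_) (sym (proj₂ (proj₂ (coefficients j) j∈J) i)))
                              (sym (sum-** (e j) (C j) a))
        ... | no j∉J rewrite e⊆J j j∉J = sym (sum-zero (λ k → 0ℙ * C j k * a k) λ _ → refl)

        column : ∀ k → sum (λ j → e j * C j k * a k) ≡ 0ℙ
        column k = trans (sym (*-distribʳ-sum (a k) (λ j → e j * C j k))) (cong (_* a k) (eC≡0 k))

open BinaryLinearAlgebra using (linearlyIndependent-augmentation)

columnMatroid : Matrix m n → Matroid n
columnMatroid A = record
  { Independent   = LinearlyIndependent A
  ; independent-⊥ = λ c c⊆⊥ _ j → c⊆⊥ j ∉⊥
  ; independent-⊆ = λ I⊆J indep c c⊆I → indep c λ j j∉J → c⊆I j (j∉J ∘ I⊆J)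
  ; augmentation  = linearlyIndependent-augmentation A
  }

private
  pattern o = 0ℙ
  pattern l = 1ℙ

matrix : Matrix 9 18
matrix =
  (o ∷ o ∷ l ∷ l ∷ o ∷ o ∷ o ∷ l ∷ o ∷ l ∷ o ∷ l ∷ o ∷ o ∷ o ∷ o ∷ o ∷ o ∷ []) ∷
  (o ∷ l ∷ o ∷ l ∷ o ∷ l ∷ o ∷ o ∷ o ∷ o ∷ o ∷ o ∷ l ∷ l ∷ o ∷ o ∷ o ∷ o ∷ []) ∷
  (o ∷ o ∷ o ∷ o ∷ o ∷ o ∷ l ∷ l ∷ o ∷ o ∷ o ∷ o ∷ o ∷ l ∷ o ∷ l ∷ o ∷ l ∷ []) ∷
  (l ∷ l ∷ l ∷ l ∷ o ∷ o ∷ o ∷ o ∷ o ∷ o ∷ o ∷ o ∷ o ∷ o ∷ o ∷ o ∷ o ∷ o ∷ []) ∷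
  (o ∷ o ∷ l ∷ l ∷ l ∷ l ∷ o ∷ o ∷ o ∷ o ∷ o ∷ o ∷ o ∷ o ∷ o ∷ o ∷ o ∷ o ∷ []) ∷
  (o ∷ o ∷ o ∷ o ∷ o ∷ o ∷ l ∷ l ∷ l ∷ l ∷ o ∷ o ∷ o ∷ o ∷ o ∷ o ∷ o ∷ o ∷ []) ∷
  (o ∷ o ∷ o ∷ o ∷ o ∷ o ∷ l ∷ l ∷ o ∷ o ∷ l ∷ l ∷ o ∷ o ∷ o ∷ o ∷ o ∷ o ∷ []) ∷
  (o ∷ o ∷ o ∷ o ∷ o ∷ o ∷ o ∷ o ∷ o ∷ o ∷ o ∷ o ∷ l ∷ l ∷ l ∷ l ∷ o ∷ o ∷ []) ∷
  (o ∷ o ∷ o ∷ o ∷ o ∷ o ∷ o ∷ o ∷ o ∷ o ∷ o ∷ o ∷ l ∷ l ∷ o ∷ o ∷ l ∷ l ∷ []) ∷ []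

-- The element j of {1,…,18} is the index j - 1 of Fin 18.
M : Matroid 18
M = columnMatroid matrix

{-# OPTIONS --safe #-}

-- Split the ground set into three blocks of six elements, and each block into
-- three legs {2j-1, 2j}.  The two columns of a leg of block i differ by tᵢ.  Call
-- a transversal of the three legs of a block even if it contains an even number of
-- the elements 2j; the columns of an even transversal of block i add up to sᵢ.
-- Here t₁ = e₂, t₂ = e₁, t₃ = e₃, while s₁ = e₁ = t₂, s₂ = e₃ = t₃, s₃ = e₂ = t₁.
-- Hence an even transversal of a block is dependent with any leg of the next one.
-- Suppose that two bases cover the ground set and that each of them contains a
-- leg of block i + 1.  Then neither contains an even transversal of block i, and
-- this forces each of them to contain a leg of block i.  By cyclicity, both bases
-- contain a leg in every block as soon as they do so in one.  An exchange leaves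
-- at least one block untouched, so it preserves this property.
module Submission where

open import Defs
open import Data.Fin.Base using (Fin; combine; quotient)
open import Data.Fin.Patterns using (0F; 1F; 2F)
open import Data.Fin.Properties using (any?; all?; remQuot-combine) renaming (_≟_ to _≟ᶠ_)
open import Data.Fin.Subset
  using (Subset; inside; outside; _∈_; _∉_; _⊆_; _∪_; _-_; ⁅_⁆; ⊤; ∁; ∣_∣)
open import Data.Fin.Subset.Properties
open import Data.Nat.Base using (ℕ; _≤_; _<_; _≥_; s≤s; z≤n)
import Data.Nat.Properties as ℕ
open import Data.Parity.Base using (Parity; 0ℙ; 1ℙ; _*_; _⁻¹) renaming (_+_ to infixl 6 _+_)
open import Data.Parity.Properties
  using (_≟_; +-*-semiring; *-zeroʳ; *-assoc; *-comm)
open import Data.Product.Base using (∃; ∃₂; _×_; _,_; proj₁; proj₂; swap)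
import Data.Product.Base as Product
open import Data.Sum.Base as Sum using (_⊎_; inj₁; inj₂; [_,_]′; fromInj₁; fromInj₂)
open import Data.Vec.Base as Vec using () renaming ([] to []ᵛ; _∷_ to _∷ᵛ_)
open import Data.Vec.Functional using (Vector; []; _∷_)
open import Data.Vec.Functional.Relation.Binary.Permutation using (_↭_)
open import Function.Base using (_∘_; case_of_)
open import Function.Bundles using (Inverse; Injection)
open import Function.Properties.Inverse using (↔⇒↣)
open import Relation.Binary.Construct.Closure.ReflexiveTransitive
  using (ε; _◅_; kleisliStar)
open import Relation.Binary.PropositionalEquality
  using (_≡_; _≢_; refl; sym; trans; cong; cong₂; subst; module ≡-Reasoning)
open import Relation.Nullary using (¬_; Dec; yes; no; contradiction)
open import Relation.Nullary.Decidable
  using (_×-dec_; _→-dec_; ¬?; decidable-stable; from-yes; from-no)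
open import Algebra.Properties.Semiring.Sum +-*-semiring
  using (sum; ∑-comm; *-distribˡ-sum; sum-cong-≗)
open Matroid M using (IsBasis)
open BinaryLinearAlgebra
  using (χ; χ-∈; χ-supported; sum-zero; sum-χ⁅⁆; nonzeroSolution)

private variable
  m n : ℕ

-- Linear independence over 𝔽₂

-- The sets `R` are the rows of a left inverse of the submatrix on the columns in `S`. This
-- certificate of independence can be decided by searching through sets of rows.
Separated : Matrix m n → Subset n → Set
Separated {m} A S = ∀ j → j ∈ S → ∃ λ (R : Subset m) →
  ∀ k → k ∈ S → sum (λ i → χ R i * entry A i k) ≡ χ ⁅ j ⁆ k

separated? : (A : Matrix m n) (S : Subset n) → Dec (Separated A S)
separated? A S = all? λ j → (j ∈? S) →-dec anySubset? λ R →
  all? λ k → (k ∈? S) →-dec (_ ≟ _)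

-- Adding up the equations `Ac≡0 i` over `i` in `R` cancels every coefficient except `c j`.
separated⇒independent : ∀ (A : Matrix m n) {S} → Separated A S → LinearlyIndependent A S
separated⇒independent A {S} separated c c⊆S Ac≡0 j with j ∈? S
... | no j∉S = c⊆S j j∉S
... | yes j∈S with separated j j∈S
...   | R , RA≡χ = begin
  c j                                                ≡⟨ sum-χ⁅⁆ j c ⟨
  sum (λ k → χ ⁅ j ⁆ k * c k)                        ≡⟨ sum-cong-≗ column ⟩
  sum (λ k → sum (λ i → χ R i * (c k * entry A i k))) ≡⟨ ∑-comm (λ k i → χ R i * (c k * entry A i k)) ⟩
  sum (λ i → sum (λ k → χ R i * (c k * entry A i k))) ≡⟨ sum-zero (λ i → sum (λ k → χ R i * (c k * entry A i k))) row ⟩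
  0ℙ                                                 ∎
  where
  open ≡-Reasoning

  column : ∀ k → χ ⁅ j ⁆ k * c k ≡ sum (λ i → χ R i * (c k * entry A i k))
  column k with k ∈? S
  ... | no k∉S rewrite c⊆S k k∉S = trans (*-zeroʳ (χ ⁅ j ⁆ k))
    (sym (sum-zero (λ i → χ R i * 0ℙ) λ i → *-zeroʳ (χ R i)))
  ... | yes k∈S = begin
    χ ⁅ j ⁆ k * c k                            ≡⟨ cong (_* c k) (RA≡χ k k∈S) ⟨
    sum (λ i → χ R i * entry A i k) * c k      ≡⟨ *-comm (sum (λ i → χ R i * entry A i k)) (c k) ⟩
    c k * sum (λ i → χ R i * entry A i k)      ≡⟨ *-distribˡ-sum (c k) (λ i → χ R i * entry A i k) ⟩
    sum (λ i → c k * (χ R i * entry A i k))    ≡⟨ sum-cong-≗ (λ i → exchange (c k) (χ R i) (entry A i k)) ⟩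
    sum (λ i → χ R i * (c k * entry A i k))    ∎
    where
    exchange : ∀ x y z → x * (y * z) ≡ y * (x * z)
    exchange x y z = trans (sym (*-assoc x y z))
      (trans (cong (_* z) (*-comm x y)) (*-assoc y x z))

  row : ∀ i → sum (λ k → χ R i * (c k * entry A i k)) ≡ 0ℙ
  row i = trans (sym (*-distribˡ-sum (χ R i) (λ k → c k * entry A i k)))
    (trans (cong (χ R i *_) (Ac≡0 i)) (*-zeroʳ (χ R i)))

independent⇒∣S∣≤m : ∀ (A : Matrix m n) {S} → LinearlyIndependent A S → ∣ S ∣ ≤ m
independent⇒∣S∣≤m {m = m} A {S} indep = ℕ.≮⇒≥ λ m<∣S∣ →
  let c , c⊆S , (j , cj≡1) , Ac≡0 =
        nonzeroSolution (entry A) ⊤ S (subst (_< ∣ S ∣) (sym (∣⊤∣≡n m)) m<∣S∣)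
  in case trans (sym cj≡1) (indep c c⊆S (λ i → Ac≡0 i ∈⊤) j) of λ ()

-- No independent set has more elements than there are rows, so one of that size is maximal.
separated⇒basis : ∀ (A : Matrix m n) {S} → Separated A S → ∣ S ∣ ≡ m →
                  Matroid.IsBasis (columnMatroid A) S
separated⇒basis A {S} separated ∣S∣≡m =
  separated⇒independent A separated , λ I indep S⊆I → ⊆-antisym
    (λ {x} x∈I → decidable-stable (x ∈? S) λ x∉S → ℕ.<-irrefl refl
      (ℕ.<-≤-trans (p⊂q⇒∣p∣<∣q∣ (S⊆I , x , x∈I , x∉S))
        (subst (∣ I ∣ ≤_) (sym ∣S∣≡m) (independent⇒∣S∣≤m A indep))))
    S⊆I

⁅x⁆⊆p : ∀ {p : Subset n} {x} → x ∈ p → ⁅ x ⁆ ⊆ p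
⁅x⁆⊆p {p = p} {x} x∈p y∈ = subst (_∈ p) (sym (x∈⁅y⁆⇒x≡y x y∈)) x∈p

p∪q⊆r : ∀ {p q r : Subset n} → p ⊆ r → q ⊆ r → p ∪ q ⊆ r
p∪q⊆r {p = p} {q} p⊆r q⊆r = [ p⊆r , q⊆r ]′ ∘ x∈p∪q⁻ p q

zeroSum⇒dependent : ∀ (A : Matrix m n) {S C : Subset n} {x} → x ∈ C → C ⊆ S →
  (∀ i → sum (λ j → χ C j * entry A i j) ≡ 0ℙ) → ¬ LinearlyIndependent A S
zeroSum⇒dependent _ {C = C} {x} x∈C C⊆S zeroSum indep =
  case trans (sym (χ-∈ x∈C)) (indep (χ C) (λ j j∉S → χ-supported C j (j∉S ∘ C⊆S)) zeroSum x) of λ ()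

-- Blocks, legs and even transversals

-- The index is `6i + 2ℓ + b` with `b` read as 0 or 1. Ends are parities so that evenness of a
-- transversal becomes an equation in `_+_`.
element : Fin 3 → Fin 3 → Parity → Fin 18
element i ℓ b = combine i (combine ℓ (end b))
  where
  end : Parity → Fin 2
  end 0ℙ = 0F
  end 1ℙ = 1F

block : Fin 18 → Fin 3
block = quotient 6

block-element : ∀ i ℓ b → block (element i ℓ b) ≡ i
block-element i ℓ b = cong proj₁ (remQuot-combine {k = 6} i _)

next : Fin 3 → Fin 3
next 0F             = 1F
next 1F       = 2F
next 2F = 0F

ContainsLeg : Subset 18 → Fin 3 → Set
ContainsLeg S i = ∃ λ ℓ → element i ℓ 0ℙ ∈ S × element i ℓ 1ℙ ∈ S

containsLeg? : ∀ S i → Dec (ContainsLeg S i)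
containsLeg? S i = any? λ ℓ → (element i ℓ 0ℙ ∈? S) ×-dec (element i ℓ 1ℙ ∈? S)

missesEnd : ∀ {S} i → ¬ ContainsLeg S i → ∀ ℓ → ∃ λ b → element i ℓ b ∉ S
missesEnd {S} i noLeg ℓ with element i ℓ 0ℙ ∈? S
... | no 0∉S  = 0ℙ , 0∉S
... | yes 0∈S = 1ℙ , λ 1∈S → noLeg (ℓ , 0∈S , 1∈S)

ContainsEvenTransversal : Subset 18 → Fin 3 → Set
ContainsEvenTransversal S i = ∃₂ λ a b →
  element i 0F a ∈ S × element i 1F b ∈ S × element i 2F (a + b) ∈ S

circuit : Fin 3 → Parity → Parity → Fin 3 → Subset 18
circuit i a b ℓ =
  ⁅ element i 0F a ⁆ ∪ ⁅ element i 1F b ⁆ ∪ ⁅ element i 2F (a + b) ⁆ ∪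
  ⁅ element (next i) ℓ 0ℙ ⁆ ∪ ⁅ element (next i) ℓ 1ℙ ⁆

-- The even transversal adds up to `sᵢ` and the leg to `tᵢ₊₁` (indices modulo 3), and these are the
-- same vector.
circuit-zeroSum : ∀ a b i ℓ r →
  sum (λ j → χ (circuit i a b ℓ) j * entry matrix r j) ≡ 0ℙ
circuit-zeroSum 0ℙ 0ℙ = from-yes (all? λ i → all? λ ℓ → all? λ r →
  sum (λ j → χ (circuit i 0ℙ 0ℙ ℓ) j * entry matrix r j) ≟ 0ℙ)
circuit-zeroSum 0ℙ 1ℙ = from-yes (all? λ i → all? λ ℓ → all? λ r →
  sum (λ j → χ (circuit i 0ℙ 1ℙ ℓ) j * entry matrix r j) ≟ 0ℙ)
circuit-zeroSum 1ℙ 0ℙ = from-yes (all? λ i → all? λ ℓ → all? λ r →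
  sum (λ j → χ (circuit i 1ℙ 0ℙ ℓ) j * entry matrix r j) ≟ 0ℙ)
circuit-zeroSum 1ℙ 1ℙ = from-yes (all? λ i → all? λ ℓ → all? λ r →
  sum (λ j → χ (circuit i 1ℙ 1ℙ ℓ) j * entry matrix r j) ≟ 0ℙ)

noEvenTransversal : ∀ {S} i → IsBasis S → ContainsLeg S (next i) → ¬ ContainsEvenTransversal S i
noEvenTransversal i (indep , _) (ℓ , 0∈S , 1∈S) (a , b , x∈S , y∈S , z∈S) =
  zeroSum⇒dependent matrix (p⊆p∪q _ (x∈⁅x⁆ _))
    (p∪q⊆r (⁅x⁆⊆p x∈S) (p∪q⊆r (⁅x⁆⊆p y∈S) (p∪q⊆r (⁅x⁆⊆p z∈S)
      (p∪q⊆r (⁅x⁆⊆p 0∈S) (⁅x⁆⊆p 1∈S))))) (circuit-zeroSum a b i ℓ) indep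

Covers : Subset 18 → Subset 18 → Set
Covers P Q = ∀ e → e ∈ P ⊎ e ∈ Q

-- Without a leg in P, some transversal lies in Q.  It is odd, and flipping any one
-- of its elements makes it even, so the flipped elements all lie in P; but the
-- transversal that they form is even.
containsLeg-cover : ∀ {P Q} i → Covers P Q →
  ¬ ContainsEvenTransversal P i → ¬ ContainsEvenTransversal Q i → ContainsLeg P i
containsLeg-cover {P} {Q} i cover noP noQ = decidable-stable (containsLeg? P i) λ noLeg →
  let a , a∉P = missesEnd i noLeg 0F
      b , b∉P = missesEnd i noLeg 1F
      c , c∉P = missesEnd i noLeg 2F
  in go a b c (other a∉P) (other b∉P) (other c∉P)
  where
  other : ∀ {e} → e ∉ P → e ∈ Q
  other {e} e∉P = fromInj₂ (λ e∈P → contradiction e∈P e∉P) (cover e)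

  unless : ∀ {e} → e ∉ Q → e ∈ P
  unless {e} e∉Q = fromInj₁ (λ e∈Q → contradiction e∈Q e∉Q) (cover e)

  third : ∀ {S b c} → b ≡ c → element i 2F b ∈ S → element i 2F c ∈ S
  third refl z∈S = z∈S

  -- Here `c` is `a + b` flipped. The first two equations make the transversal even after a flip in
  -- the first or second leg; a flip in the third gives the end `a + b`. By the last equation,
  -- flipping all three ends gives an even transversal.
  odd : ∀ a b c → c ≢ a + b → c ≡ a ⁻¹ + b × c ≡ a + b ⁻¹ × a + b ≡ a ⁻¹ + b ⁻¹
  odd 0ℙ 0ℙ 0ℙ c≢ = contradiction refl c≢
  odd 0ℙ 0ℙ 1ℙ c≢ = refl , refl , refl
  odd 0ℙ 1ℙ 0ℙ c≢ = refl , refl , refl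
  odd 0ℙ 1ℙ 1ℙ c≢ = contradiction refl c≢
  odd 1ℙ 0ℙ 0ℙ c≢ = refl , refl , refl
  odd 1ℙ 0ℙ 1ℙ c≢ = contradiction refl c≢
  odd 1ℙ 1ℙ 0ℙ c≢ = contradiction refl c≢
  odd 1ℙ 1ℙ 1ℙ c≢ = refl , refl , refl

  go : ∀ a b c → element i 0F a ∈ Q → element i 1F b ∈ Q → element i 2F c ∉ Q
  go a b c x∈Q y∈Q z∈Q with c ≟ a + b
  ... | yes refl = noQ (a , b , x∈Q , y∈Q , z∈Q)
  ... | no c≢ =
    let c≡₁ , c≡₂ , c≡₃ = odd a b c c≢
    in noP (a ⁻¹ , b ⁻¹
      , unless (λ x′∈Q → noQ (a ⁻¹ , b , x′∈Q , y∈Q , third c≡₁ z∈Q))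
      , unless (λ y′∈Q → noQ (a , b ⁻¹ , x∈Q , y′∈Q , third c≡₂ z∈Q))
      , third c≡₃ (unless λ z′∈Q → noQ (a , b , x∈Q , y∈Q , z′∈Q)))

-- The exchange invariant

LegsIn : Subset 18 × Subset 18 → Fin 3 → Set
LegsIn (P , Q) i = ContainsLeg P i × ContainsLeg Q i

Invariant : Subset 18 × Subset 18 → Set
Invariant PQ@(P , Q) = Covers P Q × ∀ i → LegsIn PQ i

legsIn-previous : ∀ {P Q} → IsBasis P → IsBasis Q → Covers P Q →
                  ∀ i → LegsIn (P , Q) (next i) → LegsIn (P , Q) i
legsIn-previous basisP basisQ cover i (legP , legQ) =
  containsLeg-cover i cover noP noQ , containsLeg-cover i (Sum.swap ∘ cover) noQ noP
  where
  noP = noEvenTransversal i basisP legP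
  noQ = noEvenTransversal i basisQ legQ

-- Stepping backwards along `next` visits all three blocks: from `k` down to `0F`, then on to `2F`
-- and `1F`.
cyclic : {T : Fin 3 → Set} → (∀ i → T (next i) → T i) → ∀ k → T k → ∀ i → T i
cyclic {T} previous k t = from₀ (to₀ k t)
  where
  to₀ : ∀ k → T k → T 0F
  to₀ 0F t = t
  to₀ 1F t = previous 0F t
  to₀ 2F t = previous 0F (previous 1F t)

  from₀ : T 0F → ∀ i → T i
  from₀ t 0F = t
  from₀ t 1F = previous 1F (previous 2F t)
  from₀ t 2F = previous 2F t

thirdBlock : ∀ i j → ∃ λ (k : Fin 3) → k ≢ i × k ≢ j
thirdBlock = from-yes (all? λ i → all? λ j → any? λ (k : Fin 3) → ¬? (k ≟ᶠ i) ×-dec ¬? (k ≟ᶠ j))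

∈-exchange : ∀ {S : Subset n} {x y e} → e ∈ S → e ≢ x → e ∈ (S - x) ∪ ⁅ y ⁆
∈-exchange {y = y} e∈S e≢x = p⊆p∪q ⁅ y ⁆ (x∈p∧x≢y⇒x∈p-y e∈S e≢x)

containsLeg-exchange : ∀ {S x y} k → k ≢ block x → ContainsLeg S k →
                       ContainsLeg ((S - x) ∪ ⁅ y ⁆) k
containsLeg-exchange {S} {x} {y} k k≢ (ℓ , 0∈S , 1∈S) = ℓ , keep 0∈S , keep 1∈S
  where
  keep : ∀ {b} → element k ℓ b ∈ S → element k ℓ b ∈ (S - x) ∪ ⁅ y ⁆
  keep {b} e∈S = ∈-exchange e∈S λ e≡x → k≢ (trans (sym (block-element k ℓ b)) (cong block e≡x))

covers-exchange : ∀ {P Q x y} → Covers P Q → Covers ((P - x) ∪ ⁅ y ⁆) ((Q - y) ∪ ⁅ x ⁆)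
covers-exchange {P} {Q} {x} {y} cover e with e ≟ᶠ x | e ≟ᶠ y
... | yes refl | _        = inj₂ (q⊆p∪q (Q - y) ⁅ x ⁆ (x∈⁅x⁆ x))
... | no _     | yes refl = inj₁ (q⊆p∪q (P - x) ⁅ y ⁆ (x∈⁅x⁆ y))
... | no e≢x   | no e≢y   = Sum.map (λ e∈P → ∈-exchange e∈P e≢x) (λ e∈Q → ∈-exchange e∈Q e≢y) (cover e)

invariant-exchange : ∀ {PQ PQ′} → SymmetricExchange M PQ PQ′ → Invariant PQ → Invariant PQ′
invariant-exchange (_ , (basisP′ , basisQ′) , x , y , _ , _ , refl , refl) (cover , legs) =
  let k , k≢x , k≢y = thirdBlock (block x) (block y)
      cover′ = covers-exchange cover
      legs′ = Product.map (containsLeg-exchange k k≢x) (containsLeg-exchange k k≢y) (legs k)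
  -- The legs kept in block `k` spread to the other blocks within the new pair, which again consists
  -- of bases covering the ground set.
  in cover′ , cyclic (legsIn-previous basisP′ basisQ′ cover′) k legs′

invariant-reachable : ∀ {PQ PQ′} → PairReachable M PQ PQ′ → Invariant PQ → Invariant PQ′
invariant-reachable ε inv = inv
invariant-reachable (inj₁ exchange ◅ steps) inv =
  invariant-reachable steps (invariant-exchange exchange inv)
invariant-reachable (inj₂ refl ◅ steps) (cover , legs) =
  invariant-reachable steps (Sum.swap ∘ cover , swap ∘ legs)

-- An exchange at the indices `1F`, `0F` is an exchange between two swaps, and a permutation of two
-- entries is the identity or a swap. Hence one example with `s = 2` settles both (a) and (b).
multisetReachable⇒pairReachable : ∀ (N : Matroid n) {B C : Vector (Subset n) 2} →
  MultisetReachable N B C →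
  PairReachable N (B 0F , B 1F) (C 0F , C 1F)
multisetReachable⇒pairReachable {n = n} N = kleisliStar (λ B → B 0F , B 1F) step
  where
  step : ∀ {B C : Vector (Subset n) 2} → ExchangeStep N B C ⊎ B ↭ C →
         PairReachable N (B 0F , B 1F) (C 0F , C 1F)
  step (inj₁ (0F , 0F , i≢j , _)) = contradiction refl i≢j
  step (inj₁ (0F , 1F , _ , exchange , _)) = inj₁ exchange ◅ ε
  step (inj₁ (1F , 0F , _ , exchange , _)) = inj₂ refl ◅ inj₁ exchange ◅ inj₂ refl ◅ ε
  step (inj₁ (1F , 1F , i≢j , _)) = contradiction refl i≢j
  step (inj₂ (ρ , B≡C)) with Inverse.to ρ 0F in ρ₀ | Inverse.to ρ 1F in ρ₁ | B≡C 0F | B≡C 1F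
  ... | 0F | 1F | e₀ | e₁ rewrite e₀ | e₁ = ε
  ... | 1F | 0F | e₀ | e₁ = inj₂ (cong₂ _,_ (sym e₀) (sym e₁)) ◅ ε
  ... | 0F | 0F | _  | _  = case Injection.injective (↔⇒↣ ρ) (trans ρ₀ (sym ρ₁)) of λ ()
  ... | 1F | 1F | _  | _  = case Injection.injective (↔⇒↣ ρ) (trans ρ₀ (sym ρ₁)) of λ ()

-- Two complementary pairs of bases

private
  pattern ● = inside
  pattern ○ = outside

-- In each block the first leg lies in this set, the third in its complement, and the second is
-- split, so both sides contain a leg in every block.
legBasis : Subset 18
legBasis = Vec.concat (Vec.replicate 3 (● ∷ᵛ ● ∷ᵛ ● ∷ᵛ ○ ∷ᵛ ○ ∷ᵛ ○ ∷ᵛ []ᵛ))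

-- The transversal of the last block is odd: were all three even, the complementary
-- ones would all be odd, and s₁ + t₁, s₂ + t₂, s₃ + t₃ add up to zero.
transversalBasis : Subset 18
transversalBasis =
  ● ∷ᵛ ○ ∷ᵛ ● ∷ᵛ ○ ∷ᵛ ● ∷ᵛ ○ ∷ᵛ
  ● ∷ᵛ ○ ∷ᵛ ● ∷ᵛ ○ ∷ᵛ ● ∷ᵛ ○ ∷ᵛ
  ● ∷ᵛ ○ ∷ᵛ ● ∷ᵛ ○ ∷ᵛ ○ ∷ᵛ ● ∷ᵛ []ᵛ

legBasis-isBasis : IsBasis legBasis
legBasis-isBasis = separated⇒basis matrix (from-yes (separated? matrix legBasis)) refl

∁legBasis-isBasis : IsBasis (∁ legBasis)
∁legBasis-isBasis = separated⇒basis matrix (from-yes (separated? matrix (∁ legBasis))) refl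

transversalBasis-isBasis : IsBasis transversalBasis
transversalBasis-isBasis = separated⇒basis matrix (from-yes (separated? matrix transversalBasis)) refl

∁transversalBasis-isBasis : IsBasis (∁ transversalBasis)
∁transversalBasis-isBasis = separated⇒basis matrix (from-yes (separated? matrix (∁ transversalBasis))) refl

sameUnion : SameMultisetUnion (legBasis ∷ ∁ legBasis ∷ []) (transversalBasis ∷ ∁ transversalBasis ∷ [])
sameUnion = from-yes (all? λ e →
  multiplicity (legBasis ∷ ∁ legBasis ∷ []) e ℕ.≟
  multiplicity (transversalBasis ∷ ∁ transversalBasis ∷ []) e)

invariant-legBasis : Invariant (legBasis , ∁ legBasis)
invariant-legBasis =
    (λ e → case e ∈? legBasis of λ where
      (yes e∈) → inj₁ e∈
      (no e∉)  → inj₂ (x∉p⇒x∈∁p e∉))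
  , from-yes (all? λ k → containsLeg? legBasis k ×-dec containsLeg? (∁ legBasis) k)

unreachable : ¬ PairReachable M (legBasis , ∁ legBasis) (transversalBasis , ∁ transversalBasis)
-- A transversal contains only one end of each leg, so the invariant already fails in block `0F`.
unreachable reachable = from-no (containsLeg? transversalBasis 0F)
  (proj₁ (proj₂ (invariant-reachable reachable invariant-legBasis) 0F))

theorem1p5 : (∃₂ λ (B₁ B₂ : Subset 18) → ∃₂ λ (B₁′ B₂′ : Subset 18) →
    IsBasis B₁ × IsBasis B₂ × IsBasis B₁′ × IsBasis B₂′
    × SameMultisetUnion (B₁ ∷ B₂ ∷ []) (B₁′ ∷ B₂′ ∷ [])
    × ¬ PairReachable M (B₁ , B₂) (B₁′ , B₂′))
    ×
    (∃ λ (s : ℕ) → s ≥ 1 × ∃₂ λ (B B′ : Vector (Subset 18) s) →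
    (∀ i → IsBasis (B i)) × (∀ i → IsBasis (B′ i))
    × SameMultisetUnion B B′
    × ¬ MultisetReachable M B B′)
theorem1p5 =
    (legBasis , ∁ legBasis , transversalBasis , ∁ transversalBasis
      , legBasis-isBasis , ∁legBasis-isBasis , transversalBasis-isBasis , ∁transversalBasis-isBasis
      , sameUnion , unreachable)
  , (2 , s≤s z≤n , (legBasis ∷ ∁ legBasis ∷ []) , (transversalBasis ∷ ∁ transversalBasis ∷ [])
      , (λ where 0F → legBasis-isBasis
                 1F → ∁legBasis-isBasis)
      , (λ where 0F → transversalBasis-isBasis
                 1F → ∁transversalBasis-isBasis)
      , sameUnion , unreachable ∘ multisetReachable⇒pairReachable M)
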